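{- Let $m\ge0$, $n=m+3$, and let $\mathcal F=(W_{i,j})$ be a closed decorated frieze of width $m$. Then $$W_{i,j}=W_{j,i+n}$$ for every $i,j\in\mathbb Z$ with $0\le j-i\le n$. Equivalently, the index transformation $G(i,j)=(j,i+n)$ leaves the decorated frieze invariant.
   Context: Fix an integer $m\ge 0$ and put $n=m+3$. Let $x_1,\dots,x_m,y_1,\dots,y_n$ be algebraically independent variables, extend $y_{i+n}=y_i$ for $i\in\mathbb Z$, and put $\mathscr R_m=\mathbb Z[x_1^{\pm1},\dots,x_m^{\pm1},y_1^{\pm1},\dots,y_n^{\pm1}]$. A closed decorated frieze of width $m$ is a family $\mathcal F=(W_{i,j})$ of elements of $\mathscr R_m$, indexed by $i,j\in\mathbb Z$ with $0\le j-i\le n$, such that: (D1) $W_{i,i}=0$ and $W_{i,i+n}=0$ for all $i$; (D2) $W_{i,i+1}=y_i$ and $W_{i,i+n-1}=y_{i-1}$ for all $i$; (D3) every interior entry, i.e. every $W_{i,j}$ with $2\le j-i\le n-2$, is nonzero; (D4) for all $i,j$ with $1\le j-i\le n-1$, $W_{i,j}W_{i+1,j+1}-W_{i+1,j}W_{i,j+1}=y_iy_j$. No periodicity of the entries is assumed. -}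

module Defs where

open import Algebra.Bundles using (CommutativeRing)
open import Data.Bool.Base using (if_then_else_)
open import Data.Fin.Base using (Fin; fromℕ<; _↑ˡ_; _↑ʳ_)
open import Data.Integer.Base as ℤ using (ℤ; +_; 0ℤ; 1ℤ) renaming (-_ to negℤ)
import Data.Integer.Properties as ℤ
open import Data.Integer.DivMod using (n%ℕd<d)
open import Data.Integer.Tactic.RingSolver using (solve-∀)
open import Data.List.Base using (List; []; _∷_; _++_; map; cartesianProductWith)
open import Data.Nat.Base as ℕ using (ℕ)
open import Data.Product.Base using (_×_; _,_; map₁)
open import Data.Vec.Base as Vec using (Vec; zipWith; replicate; _[_]≔_)
open import Data.Vec.Properties as Vec using (≡-dec)
open import Level using (0ℓ)
open import Relation.Binary.PropositionalEquality
  using (_≡_; refl; sym; trans; cong; cong₂; module ≡-Reasoning)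
open import Relation.Nullary.Decidable using (yes; no; does)
open import Relation.Nullary.Negation using (¬_; contradiction)

-- ℤ[t₁^±1, …, t_k^±1] as the group ring ℤ[ℤᵏ].
module LaurentPolynomial (k : ℕ) where

  Exponent : Set
  Exponent = Vec ℤ k

  infixl 6 _⊕_
  _⊕_ : Exponent → Exponent → Exponent
  _⊕_ = zipWith ℤ._+_

  ⊖_ : Exponent → Exponent
  ⊖_ = Vec.map negℤ

  -- The list (c₁ , a₁) ∷ (c₂ , a₂) ∷ … stands for c₁ t^a₁ + c₂ t^a₂ + ⋯;
  -- exponents may repeat and coefficients may vanish.
  Laurent : Set
  Laurent = List (ℤ × Exponent)

  -- The linear extension of t^a ↦ f a.
  ∑ : Laurent → (Exponent → ℤ) → ℤ
  ∑ []            f = 0ℤ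
  ∑ ((c , a) ∷ p) f = c ℤ.* f a ℤ.+ ∑ p f

  δ : Exponent → Exponent → ℤ
  δ e a = if does (≡-dec ℤ._≟_ a e) then 1ℤ else 0ℤ

  coeff : Laurent → Exponent → ℤ
  coeff p e = ∑ p (δ e)

  infix 4 _≈_
  record _≈_ (p q : Laurent) : Set where
    constructor mk≈
    field
      coeff≡ : ∀ e → coeff p e ≡ coeff q e
  open _≈_ public

  infixl 7 _*_
  infix  8 -_

  -_ : Laurent → Laurent
  -_ = map (map₁ negℤ)

  _·_ : ℤ × Exponent → ℤ × Exponent → ℤ × Exponent
  (c , a) · (d , b) = c ℤ.* d , a ⊕ b

  _*_ : Laurent → Laurent → Laurent
  _*_ = cartesianProductWith _·_

  monomial : Exponent → Laurent
  monomial a = (1ℤ , a) ∷ []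

  1# : Laurent
  1# = monomial (replicate k 0ℤ)

  var : Fin k → Laurent
  var j = monomial (replicate k 0ℤ [ j ]≔ 1ℤ)

  private
    variable
      f g : Exponent → ℤ

  ∑-cong : ∀ p → (∀ a → f a ≡ g a) → ∑ p f ≡ ∑ p g
  ∑-cong []            f≡g = refl
  ∑-cong ((c , a) ∷ p) f≡g = cong₂ ℤ._+_ (cong (c ℤ.*_) (f≡g a)) (∑-cong p f≡g)

  ∑-++ : ∀ p q f → ∑ (p ++ q) f ≡ ∑ p f ℤ.+ ∑ q f
  ∑-++ []            q f = sym (ℤ.+-identityˡ _)
  ∑-++ ((c , a) ∷ p) q f =
    trans (cong (λ u → c ℤ.* f a ℤ.+ u) (∑-++ p q f)) (sym (ℤ.+-assoc (c ℤ.* f a) _ _))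

  ∑-neg : ∀ p f → ∑ (- p) f ≡ ℤ.- ∑ p f
  ∑-neg []            f = refl
  ∑-neg ((c , a) ∷ p) f =
    trans (cong (λ u → ℤ.- c ℤ.* f a ℤ.+ u) (∑-neg p f)) (lemma c (f a) (∑ p f))
    where
    lemma : ∀ x y z → ℤ.- x ℤ.* y ℤ.+ ℤ.- z ≡ ℤ.- (x ℤ.* y ℤ.+ z)
    lemma = solve-∀

  ∑-0 : ∀ p → ∑ p (λ _ → 0ℤ) ≡ 0ℤ
  ∑-0 []            = refl
  ∑-0 ((c , a) ∷ p) = cong₂ ℤ._+_ (ℤ.*-zeroʳ c) (∑-0 p)

  ∑-linear : ∀ p c f g →
             ∑ p (λ a → c ℤ.* f a ℤ.+ g a) ≡ c ℤ.* ∑ p f ℤ.+ ∑ p g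
  ∑-linear []            c f g = sym (cong (ℤ._+ 0ℤ) (ℤ.*-zeroʳ c))
  ∑-linear ((d , a) ∷ p) c f g =
    trans (cong (λ u → d ℤ.* (c ℤ.* f a ℤ.+ g a) ℤ.+ u) (∑-linear p c f g))
          (lemma c d (f a) (g a) (∑ p f) (∑ p g))
    where
    lemma : ∀ c d x y u v → d ℤ.* (c ℤ.* x ℤ.+ y) ℤ.+ (c ℤ.* u ℤ.+ v)
                          ≡ c ℤ.* (d ℤ.* x ℤ.+ u) ℤ.+ (d ℤ.* y ℤ.+ v)
    lemma = solve-∀

  ∑-swap : ∀ p q (h : Exponent → Exponent → ℤ) →
           ∑ p (λ a → ∑ q (h a)) ≡ ∑ q (λ b → ∑ p (λ a → h a b))
  ∑-swap []            q h = sym (∑-0 q)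
  ∑-swap ((c , a) ∷ p) q h =
    trans (cong (λ u → c ℤ.* ∑ q (h a) ℤ.+ u) (∑-swap p q h)) (sym (∑-linear q c (h a) _))

  ∑-· : ∀ c a q f → ∑ (map ((c , a) ·_) q) f ≡ c ℤ.* ∑ q (λ b → f (a ⊕ b))
  ∑-· c a []            f = sym (ℤ.*-zeroʳ c)
  ∑-· c a ((d , b) ∷ q) f =
    trans (cong (λ u → c ℤ.* d ℤ.* f (a ⊕ b) ℤ.+ u) (∑-· c a q f))
          (lemma c d (f (a ⊕ b)) (∑ q (λ b → f (a ⊕ b))))
    where
    lemma : ∀ c d x y → c ℤ.* d ℤ.* x ℤ.+ c ℤ.* y ≡ c ℤ.* (d ℤ.* x ℤ.+ y)
    lemma = solve-∀

  ∑-* : ∀ p q f → ∑ (p * q) f ≡ ∑ p (λ a → ∑ q (λ b → f (a ⊕ b)))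
  ∑-* []            q f = refl
  ∑-* ((c , a) ∷ p) q f =
    trans (∑-++ (map ((c , a) ·_) q) (p * q) f)
          (cong₂ ℤ._+_ (∑-· c a q f) (∑-* p q f))

  ⊕-comm : ∀ a b → a ⊕ b ≡ b ⊕ a
  ⊕-comm = Vec.zipWith-comm ℤ.+-comm

  ⊕-assoc : ∀ a b c → (a ⊕ b) ⊕ c ≡ a ⊕ (b ⊕ c)
  ⊕-assoc = Vec.zipWith-assoc ℤ.+-assoc

  ⊕-identityˡ : ∀ a → replicate k 0ℤ ⊕ a ≡ a
  ⊕-identityˡ = Vec.zipWith-identityˡ ℤ.+-identityˡ

  ⊕-inverseˡ : ∀ a → (⊖ a) ⊕ a ≡ replicate k 0ℤ
  ⊕-inverseˡ = Vec.zipWith-inverseˡ ℤ.+-inverseˡ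

  ⊖-cancel : ∀ a b → (⊖ a) ⊕ (a ⊕ b) ≡ b
  ⊖-cancel a b = trans (sym (⊕-assoc (⊖ a) a b))
                   (trans (cong (_⊕ b) (⊕-inverseˡ a)) (⊕-identityˡ b))

  ⊕-cancel-⊖ : ∀ a e → a ⊕ ((⊖ a) ⊕ e) ≡ e
  ⊕-cancel-⊖ a e =
    trans (sym (⊕-assoc a (⊖ a) e))
      (trans (cong (_⊕ e) (trans (⊕-comm a (⊖ a)) (⊕-inverseˡ a))) (⊕-identityˡ e))

  δ-shift : ∀ e a b → δ e (a ⊕ b) ≡ δ ((⊖ a) ⊕ e) b
  δ-shift e a b with ≡-dec ℤ._≟_ (a ⊕ b) e | ≡-dec ℤ._≟_ b ((⊖ a) ⊕ e)
  ... | yes _  | yes _  = refl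
  ... | no  _  | no  _  = refl
  ... | yes eq | no ¬eq =
    contradiction (trans (sym (⊖-cancel a b)) (cong ((⊖ a) ⊕_) eq)) ¬eq
  ... | no ¬eq | yes eq =
    contradiction (trans (cong (a ⊕_) eq) (⊕-cancel-⊖ a e)) ¬eq

  coeff-* : ∀ p q e → coeff (p * q) e ≡ ∑ p (λ a → coeff q ((⊖ a) ⊕ e))
  coeff-* p q e =
    trans (∑-* p q (δ e)) (∑-cong p λ a → ∑-cong q λ b → δ-shift e a b)

  ++-cong : ∀ {p p′ q q′} → p ≈ p′ → q ≈ q′ → (p ++ q) ≈ (p′ ++ q′)
  ++-cong {p} {p′} {q} {q′} p≈p′ q≈q′ .coeff≡ e =
    trans (∑-++ p q (δ e))
      (trans (cong₂ ℤ._+_ (coeff≡ p≈p′ e) (coeff≡ q≈q′ e)) (sym (∑-++ p′ q′ (δ e))))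

  ++-assoc : ∀ p q r → ((p ++ q) ++ r) ≈ (p ++ (q ++ r))
  ++-assoc p q r .coeff≡ e = begin
    coeff ((p ++ q) ++ r) e                    ≡⟨ ∑-++ (p ++ q) r (δ e) ⟩
    coeff (p ++ q) e ℤ.+ coeff r e             ≡⟨ cong (ℤ._+ _) (∑-++ p q (δ e)) ⟩
    coeff p e ℤ.+ coeff q e ℤ.+ coeff r e      ≡⟨ ℤ.+-assoc (coeff p e) _ _ ⟩
    coeff p e ℤ.+ (coeff q e ℤ.+ coeff r e)    ≡⟨ cong (λ u → coeff p e ℤ.+ u) (∑-++ q r (δ e)) ⟨
    coeff p e ℤ.+ coeff (q ++ r) e             ≡⟨ ∑-++ p (q ++ r) (δ e) ⟨
    coeff (p ++ (q ++ r)) e                    ∎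
    where open ≡-Reasoning

  ++-comm : ∀ p q → (p ++ q) ≈ (q ++ p)
  ++-comm p q .coeff≡ e =
    trans (∑-++ p q (δ e))
      (trans (ℤ.+-comm (coeff p e) (coeff q e)) (sym (∑-++ q p (δ e))))

  ++-identityʳ : ∀ p → (p ++ []) ≈ p
  ++-identityʳ p .coeff≡ e = trans (∑-++ p [] (δ e)) (ℤ.+-identityʳ (coeff p e))

  -‿cong : ∀ {p q} → p ≈ q → - p ≈ - q
  -‿cong {p} {q} p≈q .coeff≡ e =
    trans (∑-neg p (δ e)) (trans (cong negℤ (coeff≡ p≈q e)) (sym (∑-neg q (δ e))))

  -‿inverseˡ : ∀ p → (- p ++ p) ≈ []
  -‿inverseˡ p .coeff≡ e =
    trans (∑-++ (- p) p (δ e))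
      (trans (cong (ℤ._+ coeff p e) (∑-neg p (δ e))) (ℤ.+-inverseˡ (coeff p e)))

  -‿inverseʳ : ∀ p → (p ++ - p) ≈ []
  -‿inverseʳ p .coeff≡ e =
    trans (coeff≡ (++-comm p (- p)) e) (coeff≡ (-‿inverseˡ p) e)

  *-comm : ∀ p q → p * q ≈ q * p
  *-comm p q .coeff≡ e = begin
    coeff (p * q) e                          ≡⟨ ∑-* p q (δ e) ⟩
    ∑ p (λ a → ∑ q (λ b → δ e (a ⊕ b)))      ≡⟨ ∑-swap p q (λ a b → δ e (a ⊕ b)) ⟩
    ∑ q (λ b → ∑ p (λ a → δ e (a ⊕ b)))      ≡⟨ ∑-cong q (λ b → ∑-cong p λ a →
                                                  cong (δ e) (⊕-comm a b)) ⟩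
    ∑ q (λ b → ∑ p (λ a → δ e (b ⊕ a)))      ≡⟨ ∑-* q p (δ e) ⟨
    coeff (q * p) e                          ∎
    where open ≡-Reasoning

  *-congˡ : ∀ p {q q′} → q ≈ q′ → p * q ≈ p * q′
  *-congˡ p {q} {q′} q≈q′ .coeff≡ e =
    trans (coeff-* p q e)
      (trans (∑-cong p λ a → coeff≡ q≈q′ ((⊖ a) ⊕ e)) (sym (coeff-* p q′ e)))

  *-cong : ∀ {p p′ q q′} → p ≈ p′ → q ≈ q′ → p * q ≈ p′ * q′
  *-cong {p} {p′} {q} {q′} p≈p′ q≈q′ .coeff≡ e = begin
    coeff (p * q) e      ≡⟨ coeff≡ (*-congˡ p q≈q′) e ⟩
    coeff (p * q′) e     ≡⟨ coeff≡ (*-comm p q′) e ⟩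
    coeff (q′ * p) e     ≡⟨ coeff≡ (*-congˡ q′ p≈p′) e ⟩
    coeff (q′ * p′) e    ≡⟨ coeff≡ (*-comm q′ p′) e ⟩
    coeff (p′ * q′) e    ∎
    where open ≡-Reasoning

  *-assoc : ∀ p q r → (p * q) * r ≈ p * (q * r)
  *-assoc p q r .coeff≡ e = begin
    coeff ((p * q) * r) e
      ≡⟨ ∑-* (p * q) r (δ e) ⟩
    ∑ (p * q) (λ a → ∑ r (λ c → δ e (a ⊕ c)))
      ≡⟨ ∑-* p q _ ⟩
    ∑ p (λ a → ∑ q (λ b → ∑ r (λ c → δ e ((a ⊕ b) ⊕ c))))
      ≡⟨ (∑-cong p λ a → ∑-cong q λ b → ∑-cong r λ c → cong (δ e) (⊕-assoc a b c)) ⟩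
    ∑ p (λ a → ∑ q (λ b → ∑ r (λ c → δ e (a ⊕ (b ⊕ c)))))
      ≡⟨ (∑-cong p λ a → ∑-* q r λ b → δ e (a ⊕ b)) ⟨
    ∑ p (λ a → ∑ (q * r) (λ b → δ e (a ⊕ b)))
      ≡⟨ ∑-* p (q * r) (δ e) ⟨
    coeff (p * (q * r)) e ∎
    where open ≡-Reasoning

  *-identityˡ : ∀ p → 1# * p ≈ p
  *-identityˡ p .coeff≡ e = begin
    coeff (1# * p) e                              ≡⟨ ∑-* 1# p (δ e) ⟩
    1ℤ ℤ.* ∑ p (λ b → δ e (0s ⊕ b)) ℤ.+ 0ℤ        ≡⟨ ℤ.+-identityʳ _ ⟩
    1ℤ ℤ.* ∑ p (λ b → δ e (0s ⊕ b))               ≡⟨ ℤ.*-identityˡ _ ⟩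
    ∑ p (λ b → δ e (0s ⊕ b))                      ≡⟨ (∑-cong p λ b → cong (δ e) (⊕-identityˡ b)) ⟩
    coeff p e                                     ∎
    where
    open ≡-Reasoning
    0s = replicate k 0ℤ

  *-identityʳ : ∀ p → p * 1# ≈ p
  *-identityʳ p .coeff≡ e = trans (coeff≡ (*-comm p 1#) e) (coeff≡ (*-identityˡ p) e)

  distribʳ : ∀ p q r → (q ++ r) * p ≈ (q * p ++ r * p)
  distribʳ p q r .coeff≡ e = begin
    coeff ((q ++ r) * p) e                  ≡⟨ ∑-* (q ++ r) p (δ e) ⟩
    ∑ (q ++ r) h                            ≡⟨ ∑-++ q r h ⟩
    ∑ q h ℤ.+ ∑ r h                         ≡⟨ cong₂ ℤ._+_ (∑-* q p (δ e)) (∑-* r p (δ e)) ⟨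
    coeff (q * p) e ℤ.+ coeff (r * p) e     ≡⟨ ∑-++ (q * p) (r * p) (δ e) ⟨
    coeff (q * p ++ r * p) e                ∎
    where
    open ≡-Reasoning
    h = λ a → ∑ p (λ b → δ e (a ⊕ b))

  distribˡ : ∀ p q r → p * (q ++ r) ≈ (p * q ++ p * r)
  distribˡ p q r .coeff≡ e = begin
    coeff (p * (q ++ r)) e       ≡⟨ coeff≡ (*-comm p (q ++ r)) e ⟩
    coeff ((q ++ r) * p) e       ≡⟨ coeff≡ (distribʳ p q r) e ⟩
    coeff (q * p ++ r * p) e     ≡⟨ coeff≡ (++-cong (*-comm q p) (*-comm r p)) e ⟩
    coeff (p * q ++ p * r) e     ∎
    where open ≡-Reasoning

  commutativeRing : CommutativeRing 0ℓ 0ℓ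
  commutativeRing = record
    { Carrier = Laurent
    ; _≈_     = _≈_
    ; _+_     = _++_
    ; _*_     = _*_
    ; -_      = -_
    ; 0#      = []
    ; 1#      = 1#
    ; isCommutativeRing = record
      { isRing = record
        { +-isAbelianGroup = record
          { isGroup = record
            { isMonoid = record
              { isSemigroup = record
                { isMagma = record
                  { isEquivalence = record
                    { refl  = mk≈ λ _ → refl
                    ; sym   = λ p≈q → mk≈ λ e → sym (coeff≡ p≈q e)
                    ; trans = λ p≈q q≈r → mk≈ λ e → trans (coeff≡ p≈q e) (coeff≡ q≈r e)
                    }
                  ; ∙-cong = ++-cong
                  }
                ; assoc = ++-assoc
                }
              ; identity = (λ _ → mk≈ λ _ → refl) , ++-identityʳ
              }
            ; inverse = -‿inverseˡ , -‿inverseʳ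
            ; ⁻¹-cong = -‿cong
            }
          ; comm = ++-comm
          }
        ; *-cong     = *-cong
        ; *-assoc    = *-assoc
        ; *-identity = *-identityˡ , *-identityʳ
        ; distrib    = distribˡ , distribʳ
        }
      ; *-comm = *-comm
      }
    }

module Frieze (m : ℕ) where

  n : ℕ
  n = 3 ℕ.+ m

  ℛ : CommutativeRing 0ℓ 0ℓ
  ℛ = LaurentPolynomial.commutativeRing (m ℕ.+ n)

  open CommutativeRing ℛ

  x : Fin m → Carrier
  x i = LaurentPolynomial.var (m ℕ.+ n) (i ↑ˡ n)

  -- y₁, …, yₙ are the last n variables, listed by the residue of their index
  -- modulo n (so yₙ comes first); the extension yᵢ₊ₙ = yᵢ to ℤ is built in.
  y : ℤ → Carrier
  y i = LaurentPolynomial.var (m ℕ.+ n) (m ↑ʳ fromℕ< (n%ℕd<d i n))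

  -- The frieze is the restriction of W to the strip 0 ≤ j - i ≤ n; the values
  -- of W outside the strip are arbitrary, and no axiom refers to them.
  record ClosedDecoratedFrieze : Set where
    field
      W : ℤ → ℤ → Carrier
      D1-lower : ∀ i → W i i ≈ 0#
      D1-upper : ∀ i → W i (i ℤ.+ + n) ≈ 0#
      D2-lower : ∀ i → W i (i ℤ.+ 1ℤ) ≈ y i
      D2-upper : ∀ i → W i (i ℤ.+ + n ℤ.- 1ℤ) ≈ y (i ℤ.- 1ℤ)
      D3 : ∀ i j → + 2 ℤ.≤ j ℤ.- i → j ℤ.- i ℤ.≤ + n ℤ.- + 2 → ¬ (W i j ≈ 0#)
      D4 : ∀ i j → 1ℤ ℤ.≤ j ℤ.- i → j ℤ.- i ℤ.≤ + n ℤ.- 1ℤ →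
           W i j * W (i ℤ.+ 1ℤ) (j ℤ.+ 1ℤ) - W (i ℤ.+ 1ℤ) j * W i (j ℤ.+ 1ℤ)
             ≈ y i * y j

-- In a domain, the Ptolemy relation (D4) propagates from the diagonal a linear
-- recurrence with coefficients W_{j,j+2} along every row,
--   y_{j+1} W_{i,j} + y_j W_{i,j+2} = W_{j,j+2} W_{i,j+1},
-- and the mirror-image recurrence, with the same coefficients, along every column.
-- Hence for fixed i both W_{i,j} and W_{j,i+n} solve the same second-order
-- recurrence in j; the boundary conditions say that they agree at j = i and j = i+1.
-- Laurent polynomials form a domain because lexicographically leading terms multiply.
module Submission where

open import Defs
open import Algebra.Bundles using (CommutativeRing)
import Algebra.Definitions as Definitions
import Algebra.Properties.Group as GroupProperties
import Algebra.Properties.Ring as RingProperties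
import Algebra.Solver.Ring.NaturalCoefficients.Default as Solver
open import Data.Bool.Base using (if_then_else_)
open import Data.Integer.Base using (ℤ; +_; _+_; _-_; _≤_; 0ℤ; 1ℤ)
import Data.Integer.Base as ℤ
import Data.Integer.Properties as ℤ
open import Data.Integer.Tactic.RingSolver using (solve-∀)
open import Data.List.Base using (List; []; _∷_; map)
open import Data.List.Membership.Propositional using (_∈_)
open import Data.List.Relation.Unary.All as All using (All; []; _∷_)
open import Data.List.Relation.Unary.Any using (here; there)
open import Data.Nat.Base as ℕ using (ℕ; zero; suc; s≤s)
import Data.Nat.Properties as ℕ
open import Data.Product.Base using (_×_; _,_; proj₁; proj₂; ∃-syntax)
open import Data.Sum.Base using (_⊎_; inj₁; inj₂; [_,_]′)
open import Data.Vec.Base using (Vec; _∷_; zipWith)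
import Data.Vec.Properties as Vec
open import Data.Vec.Relation.Binary.Lex.Strict as Lex using (Lex-<; this; next)
open import Data.Vec.Relation.Binary.Pointwise.Inductive using (Pointwise-≡⇒≡)
open import Function.Base using (_∘_)
open import Relation.Binary.Bundles using (StrictTotalOrder)
open import Relation.Binary.Definitions using (tri<; tri≈; tri>)
open import Relation.Binary.PropositionalEquality
  using (_≡_; _≢_; refl; sym; trans; cong; cong₂; subst; subst₂; module ≡-Reasoning)
open import Relation.Nullary.Decidable using (yes; no; does; ¬?)
open import Relation.Nullary.Negation using (¬_; contradiction)
open import Relation.Unary using (Pred; Decidable)
open Frieze
open ClosedDecoratedFrieze

-- Leading exponents and cancellation of Laurent polynomials.

module _ {a ℓ₁ ℓ₂} (O : StrictTotalOrder a ℓ₁ ℓ₂) where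
  open StrictTotalOrder O renaming (Carrier to A; trans to <-trans)

  -- The restriction to `P` matters: an exponent listed in a Laurent polynomial may have total
  -- coefficient 0 and must then not compete for the leading place.
  maximal : ∀ {p} {P : Pred A p} → Decidable P → ∀ xs →
            All (λ x → ¬ P x) xs ⊎ ∃[ e ] P e × All (λ x → P x → ¬ e < x) xs
  maximal P? []       = inj₁ []
  maximal P? (x ∷ xs) with P? x | maximal P? xs
  ... | no ¬px | inj₁ none           = inj₁ (¬px ∷ none)
  ... | no ¬px | inj₂ (e , pe , max) = inj₂ (e , pe , (λ px → contradiction px ¬px) ∷ max)
  ... | yes px | inj₁ none           =
    inj₂ (x , px , (λ _ → irrefl Eq.refl) ∷ All.map (λ ¬py py → contradiction py ¬py) none)
  ... | yes px | inj₂ (e , pe , max) with e <? x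
  ...   | yes e<x = inj₂ (x , px , (λ _ → irrefl Eq.refl)
                                 ∷ All.map (λ e≮y py x<y → e≮y py (<-trans e<x x<y)) max)
  ...   | no  e≮x = inj₂ (e , pe , (λ _ → e≮x) ∷ max)

_≺_ : ∀ {k} → Vec ℤ k → Vec ℤ k → Set
_≺_ = Lex-< _≡_ ℤ._<_

zipWith-+-monoʳ-≺ : ∀ {k} (a : Vec ℤ k) {b c} → b ≺ c → zipWith _+_ a b ≺ zipWith _+_ a c
zipWith-+-monoʳ-≺ (x ∷ a) (this y<z _)    = this (ℤ.+-monoʳ-< x y<z) refl
zipWith-+-monoʳ-≺ (x ∷ a) (next refl b≺c) = next refl (zipWith-+-monoʳ-≺ a b≺c)

module Cancellation (k : ℕ) where
  open LaurentPolynomial k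

  lexicographic : StrictTotalOrder _ _ _
  lexicographic = Lex.<-strictTotalOrder ℤ.<-strictTotalOrder k

  exponents : Laurent → List Exponent
  exponents = map proj₂

  δ-refl : ∀ e → δ e e ≡ 1ℤ
  δ-refl e with Vec.≡-dec ℤ._≟_ e e
  ... | yes _  = refl
  ... | no e≢e = contradiction refl e≢e

  monomial≉0 : ∀ a → ¬ monomial a ≈ []
  monomial≉0 a eq with () ← trans (sym (cong (λ u → 1ℤ ℤ.* u + 0ℤ) (δ-refl a))) (coeff≡ eq a)

  coeff≢0⇒∈ : ∀ p e → coeff p e ≢ 0ℤ → e ∈ exponents p
  coeff≢0⇒∈ []            e c≢0 = contradiction refl c≢0
  coeff≢0⇒∈ ((c , a) ∷ p) e c≢0 with Vec.≡-dec ℤ._≟_ a e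
  ... | yes refl = here refl
  ... | no _     = there (coeff≢0⇒∈ p e (c≢0 ∘ trans (cong (_+ coeff p e) (ℤ.*-zeroʳ c))
                                              ∘ trans (ℤ.+-identityˡ _)))

  -- Every exponent with nonzero coefficient occurs in the list, so a maximum over this finite list
  -- is a maximum over all exponents.
  leading : ∀ p → p ≈ [] ⊎ ∃[ e ] coeff p e ≢ 0ℤ × (∀ a → e ≺ a → coeff p a ≡ 0ℤ)
  leading p with maximal lexicographic (λ a → ¬? (coeff p a ℤ.≟ 0ℤ)) (exponents p)
  ... | inj₁ none = inj₁ (mk≈ zero-everywhere)
    where
    zero-everywhere : ∀ e → coeff p e ≡ 0ℤ
    zero-everywhere e with coeff p e ℤ.≟ 0ℤ
    ... | yes c≡0 = c≡0
    ... | no  c≢0 = contradiction c≢0 (All.lookup none (coeff≢0⇒∈ p e c≢0))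
  ... | inj₂ (e , c≢0 , max) = inj₂ (e , c≢0 , zero-above)
    where
    zero-above : ∀ a → e ≺ a → coeff p a ≡ 0ℤ
    zero-above a e≺a with coeff p a ℤ.≟ 0ℤ
    ... | yes c≡0 = c≡0
    ... | no  c≢0 = contradiction e≺a (All.lookup max (coeff≢0⇒∈ p a c≢0) c≢0)

  _∖_ : (Exponent → ℤ) → Exponent → Exponent → ℤ
  (f ∖ e) a = if does (Vec.≡-dec ℤ._≟_ a e) then 0ℤ else f a

  -- Splitting `f` into a multiple of `δ e` and a remainder vanishing at `e` collects all terms of
  -- exponent `e` at once, without normalising the list.
  ∑-split : ∀ p f e → ∑ p f ≡ f e ℤ.* coeff p e + ∑ p (f ∖ e)
  ∑-split p f e = trans (∑-cong p split) (∑-linear p (f e) (δ e) (f ∖ e))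
    where
    split : ∀ a → f a ≡ f e ℤ.* δ e a + (f ∖ e) a
    split a with Vec.≡-dec ℤ._≟_ a e
    ... | yes refl = sym (trans (ℤ.+-identityʳ _) (ℤ.*-identityʳ (f a)))
    ... | no _     = sym (trans (cong (_+ f a) (ℤ.*-zeroʳ (f e))) (ℤ.+-identityˡ (f a)))

  ∑-local-0 : ∀ p f → All (λ t → f (proj₂ t) ≡ 0ℤ) p → ∑ p f ≡ 0ℤ
  ∑-local-0 []            f []        = refl
  ∑-local-0 ((c , a) ∷ p) f (fa ∷ fp) =
    cong₂ _+_ (trans (cong (c ℤ.*_) fa) (ℤ.*-zeroʳ c)) (∑-local-0 p f fp)

  product≡0 : ∀ {x y} → x ≡ 0ℤ ⊎ y ≡ 0ℤ → x ℤ.* y ≡ 0ℤ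
  product≡0 {y = y} (inj₁ refl) = ℤ.*-zeroˡ y
  product≡0 {x}     (inj₂ refl) = ℤ.*-zeroʳ x

  -- The exponents of p may repeat, so f ⊥ p only kills ∑ p f after collecting
  -- equal exponents; the list D holds those still to be collected.
  ∑-orthogonal-on : ∀ D p f → All (λ t → f (proj₂ t) ≡ 0ℤ ⊎ proj₂ t ∈ D) p →
                    (∀ a → f a ≡ 0ℤ ⊎ coeff p a ≡ 0ℤ) → ∑ p f ≡ 0ℤ
  ∑-orthogonal-on []      p f on _ =
    ∑-local-0 p f (All.map (λ { (inj₁ z) → z ; (inj₂ ()) }) on)
  ∑-orthogonal-on (d ∷ D) p f on f⊥p = trans (∑-split p f d)
    (cong₂ _+_ (product≡0 (f⊥p d))
      (∑-orthogonal-on D p (f ∖ d) (All.map (λ {t} → on′ (proj₂ t)) on) f∖d⊥p))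
    where
    on′ : ∀ a → f a ≡ 0ℤ ⊎ a ∈ d ∷ D → (f ∖ d) a ≡ 0ℤ ⊎ a ∈ D
    on′ a a∈ with Vec.≡-dec ℤ._≟_ a d | a∈
    ... | yes _  | _                = inj₁ refl
    ... | no _   | inj₁ z           = inj₁ z
    ... | no a≢d | inj₂ (here a≡d)  = contradiction a≡d a≢d
    ... | no _   | inj₂ (there a∈D) = inj₂ a∈D
    f∖d⊥p : ∀ a → (f ∖ d) a ≡ 0ℤ ⊎ coeff p a ≡ 0ℤ
    f∖d⊥p a with Vec.≡-dec ℤ._≟_ a d
    ... | yes _ = inj₁ refl
    ... | no _  = f⊥p a

  ∑-isolate : ∀ p f e → (∀ a → a ≢ e → f a ≡ 0ℤ ⊎ coeff p a ≡ 0ℤ) →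
              ∑ p f ≡ f e ℤ.* coeff p e
  ∑-isolate p f e f⊥p = trans (∑-split p f e)
    (trans (cong (λ u → f e ℤ.* coeff p e + u)
              -- With every exponent of `p` on the collecting list, the membership condition is
              -- automatic.
              (∑-orthogonal-on (exponents p) p (f ∖ e)
                 (All.tabulate λ t∈p → inj₂ (∈-exponents t∈p)) f∖e⊥p))
           (ℤ.+-identityʳ _))
    where
    ∈-exponents : ∀ {t q} → t ∈ q → proj₂ t ∈ exponents q
    ∈-exponents (here refl) = here refl
    ∈-exponents (there t∈q) = there (∈-exponents t∈q)
    f∖e⊥p : ∀ a → (f ∖ e) a ≡ 0ℤ ⊎ coeff p a ≡ 0ℤ
    f∖e⊥p a with Vec.≡-dec ℤ._≟_ a e
    ... | yes _  = inj₁ refl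
    ... | no a≢e = f⊥p a a≢e

  noZeroDivisors : ∀ p q → p * q ≈ [] → p ≈ [] ⊎ q ≈ []
  noZeroDivisors p q pq≈0 with leading p | leading q
  ... | inj₁ p≈0 | _        = inj₁ p≈0
  ... | _        | inj₁ q≈0 = inj₂ q≈0
  ... | inj₂ (e , pe≢0 , p-above) | inj₂ (g , qg≢0 , q-above) =
    [ (λ z → contradiction z qg≢0) , (λ z → contradiction z pe≢0) ]′
      (ℤ.i*j≡0⇒i≡0∨j≡0 (coeff q g) product-of-leading)
    where
    -- `∑ p h` is the coefficient of `p * q` at `e ⊕ g`; only the exponent `e` of `p` will
    -- contribute to it.
    h : Exponent → ℤ
    h a = coeff q ((⊖ a) ⊕ (e ⊕ g))

    h⊥p : ∀ a → a ≢ e → h a ≡ 0ℤ ⊎ coeff p a ≡ 0ℤ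
    h⊥p a a≢e with StrictTotalOrder.compare lexicographic a e
    -- If `a ≺ e`, the complementary exponent of `q` lies above `g`.
    ... | tri< a≺e _ _ = inj₁ (q-above _ (subst (_≺ ((⊖ a) ⊕ (e ⊕ g))) (⊖-cancel a g)
            (zipWith-+-monoʳ-≺ (⊖ a)
              (subst (_≺ (e ⊕ g)) (⊕-comm g a) (subst ((g ⊕ a) ≺_) (⊕-comm g e)
                (zipWith-+-monoʳ-≺ g a≺e))))))
    ... | tri≈ _ a≋e _ = contradiction (Pointwise-≡⇒≡ a≋e) a≢e
    ... | tri> _ _ e≺a = inj₂ (p-above a e≺a)

    product-of-leading : coeff q g ℤ.* coeff p e ≡ 0ℤ
    product-of-leading = begin
      coeff q g ℤ.* coeff p e     ≡⟨ cong (λ b → coeff q b ℤ.* coeff p e) (⊖-cancel e g) ⟨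
      h e ℤ.* coeff p e           ≡⟨ ∑-isolate p h e h⊥p ⟨
      ∑ p h                       ≡⟨ coeff-* p q (e ⊕ g) ⟨
      coeff (p * q) (e ⊕ g)       ≡⟨ coeff≡ pq≈0 (e ⊕ g) ⟩
      0ℤ                          ∎
      where open ≡-Reasoning

  private module L = CommutativeRing commutativeRing
  open Definitions _≈_ using (AlmostLeftCancellative)
  open RingProperties L.ring using (x[y-z]≈xy-xz)
  open GroupProperties L.+-group using (x∙y⁻¹≈ε⇒x≈y; x≈y⇒x∙y⁻¹≈ε)

  *-almostCancelˡ : AlmostLeftCancellative [] _*_
  *-almostCancelˡ p q r p≉0 pq≈pr =
    [ (λ p≈0 → contradiction p≈0 p≉0) , x∙y⁻¹≈ε⇒x≈y q r ]′
      (noZeroDivisors p (q L.- r) (L.trans (x[y-z]≈xy-xz p q r) (x≈y⇒x∙y⁻¹≈ε pq≈pr)))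

-- Linear recurrences in a triangle of Ptolemy relations.

module Triangle {c ℓ} (R : CommutativeRing c ℓ) where
  open CommutativeRing R
    renaming (_+_ to _⊞_; refl to ≈-refl; sym to ≈-sym; trans to ≈-trans) hiding (_-_; zero)
  open Definitions _≈_ using (AlmostLeftCancellative)
  open RingProperties ring using (+-cancelʳ)
  open Solver commutativeSemiring using (solve; _:=_; _:+_; _:*_)
  open import Relation.Binary.Reasoning.Setoid setoid

  -- Here `a`, `b`, `c` are consecutive in one row (or column) and `a′`, `x`, `c′` are their
  -- neighbours in the adjacent one, where the recurrence is known. The product `r * s * t` occurs
  -- in both Ptolemy relations; moving it from one to the other transfers the recurrence, up to the
  -- factor `x`.
  exchange : ∀ {x a b c a′ c′ r s t k} →
             a * x ≈ a′ * b ⊞ r * t → b * c′ ≈ x * c ⊞ r * s →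
             s * a′ ⊞ t * c′ ≈ k * x → x * (s * a ⊞ t * c) ≈ x * (k * b)
  exchange {x} {a} {b} {c} {a′} {c′} {r} {s} {t} {k} ax bc′ recurrence = begin
    x * (s * a ⊞ t * c)                     ≈⟨ expand ⟩
    s * (a * x) ⊞ t * (x * c)               ≈⟨ +-congʳ (*-congˡ ax) ⟩
    s * (a′ * b ⊞ r * t) ⊞ t * (x * c)      ≈⟨ move-rst ⟩
    s * (a′ * b) ⊞ t * (x * c ⊞ r * s)      ≈⟨ +-congˡ (*-congˡ bc′) ⟨
    s * (a′ * b) ⊞ t * (b * c′)             ≈⟨ factor-b ⟩
    b * (s * a′ ⊞ t * c′)                   ≈⟨ *-congˡ recurrence ⟩
    b * (k * x)                             ≈⟨ swap ⟩
    x * (k * b)                             ∎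
    where
    expand = solve 5 (λ x a c s t →
      x :* (s :* a :+ t :* c) := s :* (a :* x) :+ t :* (x :* c)) ≈-refl x a c s t
    move-rst = solve 7 (λ x b c a′ r s t →
      s :* (a′ :* b :+ r :* t) :+ t :* (x :* c) := s :* (a′ :* b) :+ t :* (x :* c :+ r :* s))
      ≈-refl x b c a′ r s t
    factor-b = solve 5 (λ b a′ c′ s t →
      s :* (a′ :* b) :+ t :* (b :* c′) := b :* (s :* a′ :+ t :* c′)) ≈-refl b a′ c′ s t
    swap = solve 3 (λ b k x → b :* (k :* x) := x :* (k :* b)) ≈-refl b k x

  module _
    (cancel : AlmostLeftCancellative 0# _*_)
    (N : ℕ) (y : ℕ → Carrier) (w : ℕ → ℕ → Carrier)
    (y≉0 : ∀ i → ¬ y i ≈ 0#)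
    -- These are the values of `x` to be cancelled after `exchange`. They avoid row 0 and column
    -- `N`, hence the boundary zero `w 0 N`.
    (w≉0 : ∀ i j → i ℕ.< j → suc j ℕ.< N → ¬ w (suc i) (suc j) ≈ 0#)
    (diagonal : ∀ i → w i i ≈ 0#)
    (adjacent : ∀ i → w i (suc i) ≈ y i)
    (ptolemy : ∀ i j → i ℕ.< j → j ℕ.< N →
               w i j * w (suc i) (suc j) ≈ w (suc i) j * w i (suc j) ⊞ y i * y j)
    where

    -- Since `≤‴` peels its lower end, the induction starts on the diagonal `i = j`, where `w j j`
    -- vanishes, and passes from row `i + 1` to row `i`.
    row-recurrence : ∀ {i j} → i ℕ.≤‴ j → suc j ℕ.< N →
                     y (suc j) * w i j ⊞ y j * w i (2 ℕ.+ j) ≈ w j (2 ℕ.+ j) * w i (suc j)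
    row-recurrence {j = j} ℕ.≤‴-refl _ = begin
      y (suc j) * w j j ⊞ y j * w j (2 ℕ.+ j)
        ≈⟨ +-congʳ (≈-trans (*-congˡ (diagonal j)) (zeroʳ _)) ⟩
      0# ⊞ y j * w j (2 ℕ.+ j)
        ≈⟨ ≈-trans (+-identityˡ _) (*-comm _ _) ⟩
      w j (2 ℕ.+ j) * y j
        ≈⟨ *-congˡ (adjacent j) ⟨
      w j (2 ℕ.+ j) * w j (suc j) ∎
    row-recurrence {i} {j} (ℕ.≤‴-step i<j) 1+j<N =
      cancel _ _ _ (w≉0 i j i<j′ 1+j<N)
        (exchange (ptolemy i j i<j′ (ℕ.<⇒≤ 1+j<N)) (ptolemy i (suc j) (ℕ.m<n⇒m<1+n i<j′) 1+j<N)
                  (row-recurrence i<j 1+j<N))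
      where i<j′ = ℕ.≤‴⇒≤ i<j

    -- The mirror image: `≤′` peels its upper end, so the induction starts at column `i + 2` and
    -- moves to larger columns.
    column-recurrence : ∀ {i j} → 2 ℕ.+ i ℕ.≤′ j → j ℕ.≤ N →
                        y i * w (2 ℕ.+ i) j ⊞ y (suc i) * w i j ≈ w i (2 ℕ.+ i) * w (suc i) j
    column-recurrence {i} ℕ.≤′-refl _ = begin
      y i * w (2 ℕ.+ i) (2 ℕ.+ i) ⊞ y (suc i) * w i (2 ℕ.+ i)
        ≈⟨ +-congʳ (≈-trans (*-congˡ (diagonal (2 ℕ.+ i))) (zeroʳ _)) ⟩
      0# ⊞ y (suc i) * w i (2 ℕ.+ i)
        ≈⟨ ≈-trans (+-identityˡ _) (*-comm _ _) ⟩
      w i (2 ℕ.+ i) * y (suc i)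
        ≈⟨ *-congˡ (adjacent (suc i)) ⟨
      w i (2 ℕ.+ i) * w (suc i) (2 ℕ.+ i) ∎
    column-recurrence {i} {suc (suc j)} (ℕ.≤′-step 2+i≤j) j<N =
      cancel _ _ _ (w≉0 i j (ℕ.s≤s⁻¹ i+1<j) j<N)
        (exchange
          (ptolemy-comm (suc i) (suc j) i+1<j j<N)
          (ptolemy-comm i (suc j) (ℕ.<⇒≤ i+1<j) j<N)
          (column-recurrence 2+i≤j (ℕ.<⇒≤ j<N)))
      where
      i+1<j = ℕ.≤′⇒≤ 2+i≤j
      -- In a column the unprimed entries lie in the later column, so the factors come in the
      -- opposite order.
      ptolemy-comm : ∀ i j → i ℕ.< j → j ℕ.< N →
                     w (suc i) (suc j) * w i j ≈ w (suc i) j * w i (suc j) ⊞ y j * y i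
      ptolemy-comm i j i<j j<N =
        ≈-trans (*-comm _ _) (≈-trans (ptolemy i j i<j j<N) (+-congˡ (*-comm _ _)))
    column-recurrence {j = suc zero} (ℕ.≤′-step 2+i≤0) _ with () ← ℕ.≤′⇒≤ 2+i≤0

    glide : w 0 N ≈ 0# → w 1 N ≈ y 0 → ∀ {d} → d ℕ.≤ N → w 0 d ≈ w d N
    glide w0N w1N {zero} _ = ≈-trans (diagonal 0) (≈-sym w0N)
    glide w0N w1N {suc zero} _ = ≈-trans (adjacent 0) (≈-sym w1N)
    glide w0N w1N {suc (suc d)} d+2≤N =
      -- The new terms have the same coefficient `y d` in both recurrences; the old terms agree by
      -- induction and are subtracted first.
      cancel _ _ _ (y≉0 d) (+-cancelʳ (y (suc d) * w 0 d) _ _ (begin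
        y d * w 0 (2 ℕ.+ d) ⊞ y (suc d) * w 0 d   ≈⟨ +-comm _ _ ⟩
        y (suc d) * w 0 d ⊞ y d * w 0 (2 ℕ.+ d)   ≈⟨ row-recurrence ℕ.0≤‴n d+2≤N ⟩
        w d (2 ℕ.+ d) * w 0 (suc d)               ≈⟨ *-congˡ (glide w0N w1N d+1≤N) ⟩
        w d (2 ℕ.+ d) * w (suc d) N               ≈⟨ column-recurrence (ℕ.≤⇒≤′ d+2≤N) ℕ.≤-refl ⟨
        y d * w (2 ℕ.+ d) N ⊞ y (suc d) * w d N   ≈⟨ +-congˡ (*-congˡ (glide w0N w1N d≤N)) ⟨
        y d * w (2 ℕ.+ d) N ⊞ y (suc d) * w 0 d   ∎))
      where
      d+1≤N = ℕ.<⇒≤ d+2≤N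
      d≤N = ℕ.<⇒≤ d+1≤N

-- The triangle of a frieze spanned by the indices from `i` to `i + n`.

module FromBase {m : ℕ} (F : ClosedDecoratedFrieze m) (i : ℤ) where
  open CommutativeRing (ℛ m)
    renaming (_+_ to _⊞_; _-_ to _⊟_; sym to ≈-sym; trans to ≈-trans) hiding (zero)
  open GroupProperties +-group using (//-rightDividesˡ)

  shift : ℕ → ℤ
  shift a = i + + a

  shift-suc : ∀ a → shift a + 1ℤ ≡ shift (suc a)
  shift-suc a = trans (ℤ.+-assoc i (+ a) 1ℤ) (cong (λ b → i + + b) (ℕ.+-comm a 1))

  shift-difference : ∀ {a b} → a ℕ.≤ b → shift b - shift a ≡ + (b ℕ.∸ a)
  shift-difference {a} {b} a≤b = begin
    shift b - shift a   ≡⟨ cancel-base i (+ a) (+ b) ⟩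
    + b - + a           ≡⟨ ℤ.[+m]-[+n]≡m⊖n b a ⟩
    b ℤ.⊖ a             ≡⟨ ℤ.⊖-≥ a≤b ⟩
    + (b ℕ.∸ a)         ∎
    where
    open ≡-Reasoning
    cancel-base : ∀ i x z → (i + z) - (i + x) ≡ z - x
    cancel-base = solve-∀

  y′ : ℕ → Carrier
  y′ a = y m (shift a)

  W′ : ℕ → ℕ → Carrier
  W′ a b = W F (shift a) (shift b)

  adjacent : ∀ a → W′ a (suc a) ≈ y′ a
  adjacent a = subst (λ t → W F (shift a) t ≈ y′ a) (shift-suc a) (D2-lower F (shift a))

  ptolemy : ∀ a b → a ℕ.< b → b ℕ.< n m →
            W′ a b * W′ (suc a) (suc b) ≈ W′ (suc a) b * W′ a (suc b) ⊞ y′ a * y′ b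
  ptolemy a b a<b b<n = ≈-trans (≈-sym (//-rightDividesˡ _ _)) (≈-trans (+-congʳ d4)
    (+-comm (y′ a * y′ b) (W′ (suc a) b * W′ a (suc b))))
    where
    difference = shift-difference (ℕ.<⇒≤ a<b)
    d4 : W′ a b * W′ (suc a) (suc b) ⊟ W′ (suc a) b * W′ a (suc b) ≈ y′ a * y′ b
    d4 = subst₂
      (λ s t → W′ a b * W F s t ⊟ W F s (shift b) * W F (shift a) t ≈ y′ a * y′ b)
      (shift-suc a) (shift-suc b)
      (D4 F (shift a) (shift b)
        (subst (1ℤ ≤_) (sym difference) (ℤ.+≤+ (ℕ.m<n⇒0<n∸m a<b)))
        -- `+ n - 1` computes to `+ (2 + m)`, and `b - a` is at most `b`.
        (subst (_≤ + (2 ℕ.+ m)) (sym difference)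
          (ℤ.+≤+ (ℕ.≤-trans (ℕ.m∸n≤m b a) (ℕ.s≤s⁻¹ b<n)))))

  y′≉0 : ∀ a → ¬ y′ a ≈ 0#
  y′≉0 a = Cancellation.monomial≉0 (m ℕ.+ n m) _

  W′≉0 : ∀ a b → a ℕ.< b → suc b ℕ.< n m → ¬ W′ (suc a) (suc b) ≈ 0#
  W′≉0 a b a<b 1+b<n with ℕ.m≤n⇒m<n∨m≡n a<b
  -- At width 1, below the range of `D3`, the entry is a monomial by `D2-lower`.
  ... | inj₂ refl  = λ w≈0 → y′≉0 (suc a) (≈-trans (≈-sym (adjacent (suc a))) w≈0)
  ... | inj₁ 1+a<b = D3 F (shift (suc a)) (shift (suc b))
    (subst (+ 2 ≤_) (sym difference) (ℤ.+≤+ (ℕ.m+n≤o⇒m≤o∸n 2 1+a<b)))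
    -- Starting at row 1 and ending at column `n - 1` keeps the width at most `n - 2`, as `D3`
    -- demands.
    (subst (_≤ + (1 ℕ.+ m)) (sym difference)
      (ℤ.+≤+ (ℕ.≤-trans (ℕ.m∸n≤m b a) (ℕ.s≤s⁻¹ (ℕ.s≤s⁻¹ 1+b<n)))))
    where difference = shift-difference (s≤s (ℕ.<⇒≤ a<b))

  shift-0 : shift 0 ≡ i
  shift-0 = ℤ.+-identityʳ i

  W′0n : W′ 0 (n m) ≈ 0#
  W′0n = subst (λ s → W F s (shift (n m)) ≈ 0#) (sym shift-0) (D1-upper F i)

  W′1n : W′ 1 (n m) ≈ y′ 0
  -- The upper boundary is read at `i + 1`, whose entry in column `i + n` is the variable of index
  -- `i`.
  W′1n = subst₂ (λ s t → W F (shift 1) s ≈ y m t) (end i (+ n m)) (start i) (D2-upper F (shift 1))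
    where
    end : ∀ i z → i + 1ℤ + z - 1ℤ ≡ i + z
    end = solve-∀
    start : ∀ i → i + 1ℤ - 1ℤ ≡ i + 0ℤ
    start = solve-∀

  glide : ∀ {d} → d ℕ.≤ n m → W F i (shift d) ≈ W F (shift d) (shift (n m))
  glide {d} d≤n = subst (λ s → W F s (shift d) ≈ W F (shift d) (shift (n m))) shift-0
    (Triangle.glide (ℛ m) (Cancellation.*-almostCancelˡ (m ℕ.+ n m)) (n m) y′ W′ y′≉0 W′≉0
      (λ a → D1-lower F (shift a)) adjacent ptolemy W′0n W′1n d≤n)

theorem2p10 : (m : ℕ) (F : ClosedDecoratedFrieze m) (i j : ℤ) →
    + 0 ≤ j - i → j - i ≤ + n m →
    CommutativeRing._≈_ (ℛ m) (W F i j) (W F j (i + + n m))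
theorem2p10 m F i j 0≤j-i j-i≤n =
  -- With `i` itself as base point, the claim compares row 0 with column `n` at `d`, the absolute
  -- value of `j - i`.
  subst (λ t → CommutativeRing._≈_ (ℛ m) (W F i t) (W F t (i + + n m))) i+d≡j
    (FromBase.glide F i (ℤ.drop‿+≤+ (subst (_≤ + n m) (sym d≡j-i) j-i≤n)))
  where
  d≡j-i : + ℤ.∣ j - i ∣ ≡ j - i
  d≡j-i = ℤ.0≤i⇒+∣i∣≡i 0≤j-i
  i+d≡j : i + + ℤ.∣ j - i ∣ ≡ j
  i+d≡j = trans (cong (λ t → i + t) d≡j-i) (move i j)
    where
    move : ∀ i j → i + (j - i) ≡ j
    move = solve-∀
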